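{- Let $\lambda$ be a cardinal with $\omega_1<\lambda<2^{\omega_1}$. Suppose that there exists a tree $T$ of height $\omega_1$ such that (i) $T$ has exactly $\lambda$ uncountable branches, and (ii) each level of $T$ has at most $\omega_1$ nodes. Then there is a structure $\mathcal M$ of cardinality $\omega_1$ with exactly $\lambda$ automorphisms.
   Context: A tree is a partially ordered set in which the set of predecessors of every node is well-ordered; the height of a node is the order type of its set of predecessors, and the levels are the sets of nodes of a given height. A branch is a maximal linearly ordered subset; in a tree of height $\omega_1$ the uncountable branches are those of order type $\omega_1$. The vocabulary of the structure may be uncountable. -}

module Defs where

open import Data.Bool.Base using (Bool)
open import Data.Nat.Base using (ℕ)
open import Data.Product.Base using (Σ; Σ-syntax; _×_; _,_; proj₁)
open import Data.Sum.Base using (_⊎_)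
open import Data.Vec.Base using (Vec; map)
open import Function.Base using (_on_)
open import Function.Bundles using (Bijection; Injection; _⇔_)
open import Function.Definitions using (Bijective)
open import Induction.WellFounded using (WellFounded)
open import Level using (Level; 0ℓ; suc; _⊔_)
open import Relation.Binary.Bundles using (Setoid)
open import Relation.Binary.Core using (Rel)
open import Relation.Binary.Morphism.Structures using (IsOrderIsomorphism)
open import Relation.Binary.PropositionalEquality using (_≡_; setoid; _→-setoid_)
open import Relation.Binary.Structures using (IsStrictPartialOrder; IsStrictTotalOrder)
open import Relation.Nullary using (¬_)
open import Relation.Unary using (Pred; _⊆_; _≐_)
import Relation.Binary.Construct.On as On

-- The sets of the ambient (classical) set theory are the types in Set.
-- Collections without a canonical choice of representatives (subsets,
-- branches, automorphisms, 2^κ) are setoids whose equality is the extensional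
-- one, and their cardinalities are compared by maps respecting that equality.
-- Excluded middle for all types, not just propositions, is assumed where these
-- notions are used; as Σ is untruncated it yields the axiom of choice as well.

private
  variable
    a b ℓ₁ ℓ₂ : Level

infix 4 _≈ᶜ_ _≤ᶜ_ _<ᶜ_

_≈ᶜ_ _≤ᶜ_ _<ᶜ_ : Setoid a ℓ₁ → Setoid b ℓ₂ → Set (a ⊔ b ⊔ ℓ₁ ⊔ ℓ₂)
A ≈ᶜ B = Bijection A B
A ≤ᶜ B = Injection A B
A <ᶜ B = (A ≤ᶜ B) × ¬ (A ≈ᶜ B)

Countable Uncountable : Setoid a ℓ₁ → Set (a ⊔ ℓ₁)
Countable   A = A ≤ᶜ setoid ℕ
Uncountable A = ¬ Countable A

-- Equality ignores the membership proof, so that P counts as a subset even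
-- when it is not proof-irrelevant.
subset : {A : Set} → Pred A 0ℓ → Setoid 0ℓ 0ℓ
subset {A} P = On.setoid {B = Σ A P} (setoid A) proj₁

record IsWellOrder {A : Set} (_≈_ _<_ : Rel A 0ℓ) : Set where
  field
    isStrictTotalOrder : IsStrictTotalOrder _≈_ _<_
    wellFounded        : WellFounded _<_

  open IsStrictTotalOrder isStrictTotalOrder public

-- A cardinal is an initial ordinal: a well-order not equinumerous with any of
-- its proper initial segments.  The elements of the carrier are the ordinals
-- below it.
record Cardinal : Set₁ where
  infix 4 _<_
  field
    Carrier     : Set
    _<_         : Rel Carrier 0ℓ
    isWellOrder : IsWellOrder _≡_ _<_

  Below : Carrier → Pred Carrier 0ℓ
  Below α β = β < α

  field
    initial : ∀ α → ¬ (subset (Below α) ≈ᶜ setoid Carrier)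

∣_∣ : Cardinal → Setoid 0ℓ 0ℓ
∣ κ ∣ = setoid (Cardinal.Carrier κ)

2^_ : Cardinal → Setoid 0ℓ 0ℓ
2^ κ = Cardinal.Carrier κ →-setoid Bool

-- ω₁ is determined up to isomorphism as the least uncountable ordinal.
record IsOmega₁ (κ : Cardinal) : Set where
  open Cardinal κ
  field
    uncountable : Uncountable ∣ κ ∣
    least       : ∀ α → Countable (subset (Below α))

record Tree : Set₁ where
  infix 4 _<_
  field
    Node                 : Set
    _<_                  : Rel Node 0ℓ
    isStrictPartialOrder : IsStrictPartialOrder _≡_ _<_

  Predecessor : Node → Pred Node 0ℓ
  Predecessor t s = s < t

  field
    predecessors-wellOrdered : ∀ t →
      IsWellOrder {Σ Node (Predecessor t)} (_≡_ on proj₁) (_<_ on proj₁)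

module _ (T : Tree) where
  open Tree T

  IsChain : Pred (Pred Node 0ℓ) 0ℓ
  IsChain C = ∀ {s t} → C s → C t → s < t ⊎ s ≡ t ⊎ t < s

  record IsBranch (B : Pred Node 0ℓ) : Set₁ where
    field
      isChain : IsChain B
      maximal : ∀ {C : Pred Node 0ℓ} → IsChain C → B ⊆ C → C ⊆ B

  UncountableBranch : Set₁
  UncountableBranch = Σ[ B ∈ Pred Node 0ℓ ] IsBranch B × Uncountable (subset B)

  uncountableBranches : Setoid (suc 0ℓ) 0ℓ
  uncountableBranches = record
    { Carrier       = UncountableBranch
    ; _≈_           = _≐_ on proj₁
    ; isEquivalence = record
      { refl  = (λ x → x) , (λ x → x)
      ; sym   = λ (f , g) → g , f
      ; trans = λ (f , g) (h , k) → (λ x → h (f x)) , (λ x → g (k x))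
      }
    }

  module _ (κ : Cardinal) where
    private module κ = Cardinal κ

    HeightOf : Node → κ.Carrier → Set
    HeightOf t α =
      Σ[ f ∈ (Σ Node (Predecessor t) → Σ κ.Carrier (κ.Below α)) ]
        IsOrderIsomorphism (_≡_ on proj₁) (_≡_ on proj₁) (_<_ on proj₁) (κ._<_ on proj₁) f

    Level[_] : κ.Carrier → Pred Node 0ℓ
    Level[ α ] t = HeightOf t α

    -- The height of a tree is the least ordinal at which its level is empty.
    record HasHeight : Set where
      field
        bounded  : ∀ t → Σ[ α ∈ κ.Carrier ] Level[ α ] t
        nonempty : ∀ α → Σ[ t ∈ Node ] Level[ α ] t

record Vocabulary : Set₁ where
  field
    FunctionSymbol : Set
    RelationSymbol : Set
    functionArity  : FunctionSymbol → ℕ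
    relationArity  : RelationSymbol → ℕ

record Structure (L : Vocabulary) : Set₁ where
  open Vocabulary L
  field
    Universe : Set
    function : (F : FunctionSymbol) → Vec Universe (functionArity F) → Universe
    relation : (R : RelationSymbol) → Pred (Vec Universe (relationArity R)) 0ℓ

module _ {L : Vocabulary} (M : Structure L) where
  open Vocabulary L
  open Structure M

  record Automorphism : Set where
    field
      to                 : Universe → Universe
      bijective          : Bijective _≡_ _≡_ to
      preserves-function : ∀ F xs → to (function F xs) ≡ function F (map to xs)
      preserves-relation : ∀ R xs → relation R xs ⇔ relation R (map to xs)

  automorphisms : Setoid 0ℓ 0ℓ
  automorphisms = On.setoid (Universe →-setoid Universe) Automorphism.to

{-# OPTIONS --safe #-}
-- For α < ω₁ let G_α be the group, under sum modulo 2, of finite sets of nodes at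
-- level α, with the projections G_β → G_α for α ≤ β.  The structure is the disjoint
-- union of the G_α with relations naming levels, projections and translations, so
-- that an automorphism is a translation by a coherent sequence, an element of the
-- inverse limit.  By the regularity of ω₁ the sizes of the finite sets in a coherent
-- sequence are bounded, hence the sequence is a finite sum of uncountable branches.
-- Thus there are as many automorphisms as finite sets of branches, namely λ by
-- Hessenberg's theorem, which also gives the structure cardinality ω₁.
--
-- An element of the inverse limit is the same as a function h : Node → Bool, where
-- h s is the coefficient of s at its own level.  Instead of projecting finite sets,
-- an element of G_α is represented by any list c of nodes of height at least α; its
-- coefficient at s is the parity of the number of members of c extending s.
module Submission where

open import Defs
open import Axiom.ExcludedMiddle using (ExcludedMiddle)
open import Data.Bool.Base using (Bool; true; false; _xor_)
open import Data.Bool.Properties using (xor-assoc; xor-comm; xor-same; xor-identityʳ)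
open import Data.Empty using (⊥; ⊥-elim)
open import Data.List.Base using (List; []; _∷_; foldr; length; map)
open import Data.List.Membership.Propositional using (_∈_)
open import Data.List.Membership.Propositional.Properties using (∈-∃++)
open import Data.List.Properties using (map-injective)
open import Data.List.Relation.Binary.Permutation.Propositional using (_↭_; ↭-sym; prep; swap) renaming (refl to ↭-refl; trans to ↭-trans)
open import Data.List.Relation.Binary.Permutation.Propositional.Properties using (shift; ↭-length; ∈-resp-↭)
open import Data.List.Relation.Unary.Any using (here; there)
open import Data.Nat.Base as ℕ using (ℕ; zero; suc)
import Data.Nat.Properties as ℕ
open import Data.Product.Base using (Σ; Σ-syntax; ∃; _×_; _,_; proj₁; proj₂)
open import Data.Product.Properties using (,-injectiveˡ; ,-injectiveʳ)
import Data.Product.Relation.Binary.Lex.Strict as Lex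
open import Data.Sum.Base using (_⊎_; inj₁; inj₂)
open import Data.Unit.Base using (tt)
open import Data.Vec.Base using ([]; _∷_)
open import Function.Base using (_∘_; _on_; id)
open import Function.Bundles using (Bijection; Injection; Equivalence; mk⇔)
import Function.Construct.Composition as Composition
import Function.Construct.Identity as Identity
open import Function.Definitions using (Injective)
open import Induction.WellFounded using (WellFounded; WfRec; module All; module FixPoint; wf⇒asym)
open import Level using (Level; 0ℓ; _⊔_)
open import Relation.Binary.Bundles using (Setoid)
import Relation.Binary.Construct.On as On
import Relation.Binary.Construct.StrictToNonStrict as NonStrict
open import Relation.Binary.Core using (Rel)
open import Relation.Binary.Definitions using (Trichotomous; tri<; tri≈; tri>)
open import Relation.Binary.Morphism.Structures using (IsOrderIsomorphism)
open import Relation.Binary.PropositionalEquality using (_≡_; _≢_; refl; sym; trans; cong; cong₂; subst; subst₂; setoid; resp₂; isEquivalence; module ≡-Reasoning)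
open import Relation.Binary.Structures using (IsStrictPartialOrder)
open import Relation.Nullary using (¬_; does; yes; no; contradiction)
open import Relation.Nullary.Decidable using (decidable-stable; dec-true; does-⇔)
open import Relation.Unary using (Pred; U; _⊆_; _⟨×⟩_; _≐_)

-- Injections between subsets, and codes for pairs and lists.

private
  variable
    a b c ℓ ℓ₁ ℓ₂ ℓ₃ : Level
    A : Set a
    B : Set b
    C : Set c
    I : Set a

-- Injections between subsets are given by functions on the ambient types, so
-- that they cannot depend on membership proofs.
infix 4 _≲_

record _≲_ {A : Set a} {B : Set b} (P : Pred A ℓ₁) (Q : Pred B ℓ₂) : Set (a ⊔ b ⊔ ℓ₁ ⊔ ℓ₂) where
  field
    to        : A → B
    into      : ∀ {x} → P x → Q (to x)
    injective : ∀ {x y} → P x → P y → to x ≡ to y → x ≡ y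

open _≲_

IsCountable : {A : Set a} → Pred A ℓ → Set (a ⊔ ℓ)
IsCountable P = P ≲ U {A = ℕ}

HasSquareInjection : {A : Set a} → Pred A ℓ → Set (a ⊔ ℓ)
HasSquareInjection P = (P ⟨×⟩ P) ≲ P

⊆⇒≲ : {P : Pred A ℓ₁} {Q : Pred A ℓ₂} → P ⊆ Q → P ≲ Q
⊆⇒≲ P⊆Q = record { to = id ; into = P⊆Q ; injective = λ _ _ eq → eq }

≲-trans : {P : Pred A ℓ₁} {Q : Pred B ℓ₂} {R : Pred C ℓ₃} → P ≲ Q → Q ≲ R → P ≲ R
≲-trans f g = record
  { to        = to g ∘ to f
  ; into      = into g ∘ into f
  ; injective = λ p q eq → injective f p q (injective g (into f p) (into f q) eq)
  }

⟨×⟩-mono-≲ : {P : Pred A ℓ₁} {Q : Pred B ℓ₂} → P ≲ Q → (P ⟨×⟩ P) ≲ (Q ⟨×⟩ Q)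
⟨×⟩-mono-≲ f = record
  { to        = λ (x , y) → to f x , to f y
  ; into      = λ (p , q) → into f p , into f q
  ; injective = λ (p , q) (p′ , q′) eq →
      cong₂ _,_ (injective f p p′ (,-injectiveˡ eq)) (injective f q q′ (,-injectiveʳ eq))
  }

-- This is `2^m * (2n + 1)`; injectivity is the uniqueness of the odd part.
pairℕ : ℕ → ℕ → ℕ
pairℕ zero    n = suc (2 ℕ.* n)
pairℕ (suc m) n = 2 ℕ.* pairℕ m n

pairℕ-injective : ∀ m n m′ n′ → pairℕ m n ≡ pairℕ m′ n′ → (m , n) ≡ (m′ , n′)
pairℕ-injective zero n zero n′ eq =
  cong (zero ,_) (ℕ.*-cancelˡ-≡ n n′ 2 (ℕ.suc-injective eq))
pairℕ-injective zero n (suc m′) n′ eq = ⊥-elim (ℕ.even≢odd (pairℕ m′ n′) n (sym eq))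
pairℕ-injective (suc m) n zero n′ eq = ⊥-elim (ℕ.even≢odd (pairℕ m n) n′ eq)
pairℕ-injective (suc m) n (suc m′) n′ eq =
  cong (λ (i , j) → suc i , j) (pairℕ-injective m n m′ n′ (ℕ.*-cancelˡ-≡ _ _ 2 eq))

ℕ-square : HasSquareInjection (U {A = ℕ})
ℕ-square = record
  { to        = λ (m , n) → pairℕ m n
  ; into      = λ _ → tt
  ; injective = λ {(m , n)} {(m′ , n′)} _ _ → pairℕ-injective m n m′ n′
  }

module ListCode {A : Set} (sq : HasSquareInjection (U {A = A})) {u v : A} (u≢v : u ≢ v) where

  pair : A × A → A
  pair = to sq

  pair-injective : Injective _≡_ _≡_ pair
  pair-injective = injective sq (tt , tt) (tt , tt)

  -- The leading tag, `u` or `v`, separates the empty list from the others, so lists of different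
  -- lengths never share a code.
  code : List A → A
  code []       = pair (u , u)
  code (x ∷ xs) = pair (v , pair (x , code xs))

  code-injective : Injective _≡_ _≡_ code
  code-injective {[]}     {[]}     _  = refl
  code-injective {[]}     {y ∷ ys} eq = contradiction (,-injectiveˡ (pair-injective eq)) u≢v
  code-injective {x ∷ xs} {[]}     eq = contradiction (sym (,-injectiveˡ (pair-injective eq))) u≢v
  code-injective {x ∷ xs} {y ∷ ys} eq =
    let eq′ = pair-injective (,-injectiveʳ (pair-injective eq))
    in cong₂ _∷_ (,-injectiveˡ eq′) (code-injective (,-injectiveʳ eq′))

-- Excluded middle, and the Cantor-Bernstein theorem for setoids.

module Classical (em : ∀ {ℓ} → ExcludedMiddle ℓ) where

  by-contradiction : {P : Set ℓ} → ¬ ¬ P → P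
  by-contradiction = decidable-stable em

  ¬∀⇒∃¬ : {A : Set a} {P : Pred A ℓ} → ¬ (∀ x → P x) → ∃ λ x → ¬ P x
  ¬∀⇒∃¬ ¬∀ = by-contradiction λ ¬∃ → ¬∀ λ x → by-contradiction λ ¬p → ¬∃ (x , ¬p)

  ≤ᶜ⇒≲ : {A B : Set} {P : Pred A 0ℓ} → B → subset P ≤ᶜ setoid B → P ≲ U {A = B}
  ≤ᶜ⇒≲ {A} {B} {P} d f = record { to = g ; into = λ _ → tt ; injective = inj }
    where
    open Injection f using () renaming (to to fun; injective to fun-injective; cong to fun-cong)

    g : A → B
    g x with em {P = P x}
    ... | yes p = fun (x , p)
    ... | no _  = d

    g≡ : ∀ {x} (p : P x) → g x ≡ fun (x , p)
    g≡ {x} p with em {P = P x}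
    -- The membership proofs `p` and `q` may differ, but equality in `subset P` ignores them.
    ... | yes q = fun-cong refl
    ... | no ¬p = contradiction p ¬p

    inj : ∀ {x y} → P x → P y → g x ≡ g y → x ≡ y
    inj p q eq = fun-injective (trans (sym (g≡ p)) (trans eq (g≡ q)))

  module CantorBernstein {X : Setoid a ℓ₁} {Y : Setoid b ℓ₂} (f : X ≤ᶜ Y) (g : Y ≤ᶜ X) where
    private
      module X = Setoid X
      module Y = Setoid Y
      module f = Injection f
      module g = Injection g

    -- These points are reached from outside the range of `g` by iterating `g` after `f`. The
    -- bijection follows `f` on them and inverts `g` elsewhere.
    data Core : X.Carrier → Set (a ⊔ b ⊔ ℓ₁) where
      base : ∀ {x} → ¬ (∃ λ y → g.to y X.≈ x) → Core x
      step : ∀ {x x′} → Core x → x′ X.≈ g.to (f.to x) → Core x′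

    Core-resp-≈ : ∀ {x x′} → x X.≈ x′ → Core x → Core x′
    Core-resp-≈ x≈x′ (base ¬im)   = base λ (y , gy≈x′) → ¬im (y , X.trans gy≈x′ (X.sym x≈x′))
    Core-resp-≈ x≈x′ (step x₀ eq) = step x₀ (X.trans (X.sym x≈x′) eq)

    preimage : ∀ {x} → ¬ Core x → ∃ λ y → g.to y X.≈ x
    preimage ¬core = by-contradiction λ ¬im → ¬core (base ¬im)

    -- A relation rather than a function: preimages under `g` are chosen, and must be shown
    -- independent of the choice up to equality.
    data Image (x : X.Carrier) (y : Y.Carrier) : Set (a ⊔ b ⊔ ℓ₁ ⊔ ℓ₂) where
      core  : Core x → y Y.≈ f.to x → Image x y
      outer : ¬ Core x → g.to y X.≈ x → Image x y

    image : ∀ x → ∃ (Image x)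
    image x with em {P = Core x}
    ... | yes cx = f.to x , core cx Y.refl
    ... | no ¬cx = let y , eq = preimage ¬cx in y , outer ¬cx eq

    Image-functional : ∀ {x x′ y y′} → x X.≈ x′ → Image x y → Image x′ y′ → y Y.≈ y′
    Image-functional eq (core _ p)    (core _ q)     = Y.trans p (Y.trans (f.cong eq) (Y.sym q))
    Image-functional eq (core cx _)   (outer ¬cx′ _) = contradiction (Core-resp-≈ eq cx) ¬cx′
    Image-functional eq (outer ¬cx _) (core cx′ _)   =
      contradiction (Core-resp-≈ (X.sym eq) cx′) ¬cx
    Image-functional eq (outer _ p)   (outer _ q)    =
      g.injective (X.trans p (X.trans eq (X.sym q)))

    -- In the mixed cases the outer point would equal `g` after `f` of a core point, and so lie in
    -- the core itself.
    Image-injective : ∀ {x x′ y y′} → y Y.≈ y′ → Image x y → Image x′ y′ → x X.≈ x′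
    Image-injective eq (core _ p)    (core _ q)     =
      f.injective (Y.trans (Y.sym p) (Y.trans eq q))
    Image-injective eq (core cx p)   (outer ¬cx′ q) =
      contradiction (step cx (X.trans (X.sym q) (g.cong (Y.trans (Y.sym eq) p)))) ¬cx′
    Image-injective eq (outer ¬cx p) (core cx′ q)   =
      contradiction (step cx′ (X.trans (X.sym p) (g.cong (Y.trans eq q)))) ¬cx
    Image-injective eq (outer _ p)   (outer _ q)    =
      X.trans (X.sym p) (X.trans (g.cong eq) q)

    Image-surjective : ∀ y → ∃ λ x → Image x y
    Image-surjective y with em {P = Core (g.to y)}
    ... | no ¬core           = g.to y , outer ¬core X.refl
    ... | yes (base ¬im)     = contradiction (y , X.refl) ¬im
    ... | yes (step {x} cx eq) = x , core cx (g.injective eq)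

    bijection : X ≈ᶜ Y
    bijection = record
      { to        = λ x → proj₁ (image x)
      ; cong      = λ {x} {x′} eq → Image-functional eq (proj₂ (image x)) (proj₂ (image x′))
      ; bijective =
          (λ {x} {x′} eq → Image-injective eq (proj₂ (image x)) (proj₂ (image x′)))
        , λ y → let x , im = Image-surjective y
                in x , λ {z} z≈x → Image-functional z≈x (proj₂ (image z)) im
      }

  -- Well-ordered cardinals and least elements.

  module WellOrdered (κ : Cardinal) where
    open Cardinal κ public
    open IsWellOrder isWellOrder public
      using (wellFounded; compare; irrefl)
      renaming (trans to <-trans)
    open NonStrict _≡_ _<_ public using (_≤_)

    <-asym : ∀ {α β} → α < β → ¬ (β < α)
    <-asym = wf⇒asym wellFounded

    ≤-refl : ∀ {α} → α ≤ α
    ≤-refl = inj₂ refl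

    ≤-trans : ∀ {α β γ} → α ≤ β → β ≤ γ → α ≤ γ
    ≤-trans = NonStrict.trans _≡_ _<_ isEquivalence (resp₂ _<_) <-trans

    ≤⇒≯ : ∀ {α β} → α ≤ β → ¬ (β < α)
    ≤⇒≯ (inj₁ α<β)  = <-asym α<β
    ≤⇒≯ (inj₂ refl) = irrefl refl

    ≮⇒≥ : ∀ {α β} → ¬ (α < β) → β ≤ α
    ≮⇒≥ {α} {β} α≮β with compare α β
    ... | tri< α<β _ _ = contradiction α<β α≮β
    ... | tri≈ _ α≡β _ = inj₂ (sym α≡β)
    ... | tri> _ _ β<α = inj₁ β<α

    upperBound : ∀ α β → ∃ λ γ → α ≤ γ × β ≤ γ
    upperBound α β with compare α β
    ... | tri< α<β _ _ = β , inj₁ α<β , ≤-refl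
    ... | tri≈ _ α≡β _ = β , inj₂ α≡β , ≤-refl
    ... | tri> _ _ β<α = α , ≤-refl , inj₁ β<α

    infixl 6 _⊔ₒ_
    _⊔ₒ_ : Carrier → Carrier → Carrier
    α ⊔ₒ β = proj₁ (upperBound α β)

    α≤α⊔β : ∀ α β → α ≤ α ⊔ₒ β
    α≤α⊔β α β = proj₁ (proj₂ (upperBound α β))

    β≤α⊔β : ∀ α β → β ≤ α ⊔ₒ β
    β≤α⊔β α β = proj₂ (proj₂ (upperBound α β))

    Least : Pred Carrier ℓ → Pred Carrier ℓ
    Least P α = P α × (∀ {β} → β < α → ¬ P β)

    least-exists : {P : Pred Carrier ℓ} → ∃ P → ∃ (Least P)
    least-exists {ℓ} {P} (α , pα) = All.wfRec wellFounded ℓ (λ β → P β → ∃ (Least P)) go α pα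
      where
      go : ∀ β → WfRec _<_ (λ γ → P γ → ∃ (Least P)) β → P β → ∃ (Least P)
      go β rec pβ with em {P = ∃ λ γ → γ < β × P γ}
      ... | yes (γ , γ<β , pγ) = rec γ<β pγ
      ... | no ¬smaller        = β , pβ , λ γ<β pγ → ¬smaller (_ , γ<β , pγ)

    least-unique : {P : Pred Carrier ℓ₁} {Q : Pred Carrier ℓ₂} → P ⊆ Q → Q ⊆ P →
                   ∀ {α β} → Least P α → Least Q β → α ≡ β
    least-unique P⊆Q Q⊆P {α} {β} (pα , α-min) (qβ , β-min) with compare α β
    ... | tri< α<β _ _ = contradiction (P⊆Q pα) (β-min α<β)
    ... | tri≈ _ α≡β _ = α≡β
    ... | tri> _ _ β<α = contradiction (Q⊆P qβ) (α-min β<α)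

    -- Choosing the least representative makes the choice depend only on the
    -- equivalence class, without quotients.
    classify : (S : Setoid a ℓ₁) (Rep : Setoid.Carrier S → Pred Carrier ℓ) →
               (∀ x → ∃ (Rep x)) →
               (∀ {x y} → Setoid._≈_ S x y → Rep x ⊆ Rep y) →
               (∀ {x y α} → Rep x α → Rep y α → Setoid._≈_ S x y) →
               S ≤ᶜ setoid Carrier
    classify S Rep total resp functional = record
      { to        = λ x → proj₁ (leastRep x)
      ; cong      = λ {x} {y} x~y →
          least-unique (resp x~y) (resp (S.sym x~y)) (proj₂ (leastRep x)) (proj₂ (leastRep y))
      ; injective = λ {x} {y} eq →
          functional (proj₁ (proj₂ (leastRep x)))
                     (subst (Rep y) (sym eq) (proj₁ (proj₂ (leastRep y))))
      }
      where
      module S = Setoid S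
      leastRep : ∀ x → ∃ (Least (Rep x))
      leastRep x = least-exists (total x)

    -- Injections built by transfinite recursion.

    module Greedy {W : Set} {_≺_ : Rel W 0ℓ} (≺-wellFounded : WellFounded _≺_)
                  (≺-compare : Trichotomous _≡_ _≺_) (default : Carrier)
                  (D : Pred W 0ℓ) (P : Pred Carrier 0ℓ) where

      Fresh : ∀ w → WfRec _≺_ (λ _ → Carrier) w → Pred Carrier 0ℓ
      Fresh w values α = P α × (∀ {v} (v≺w : v ≺ w) → D v → values v≺w ≢ α)

      pick : Pred Carrier 0ℓ → Carrier
      pick Q with em {P = ∃ Q}
      ... | yes q = proj₁ (least-exists q)
      ... | no _  = default

      -- Taking the least element makes the choice extensional, which the unfolding law of the
      -- recursion requires of its step function.
      pick-cong : ∀ {Q R} → Q ⊆ R → R ⊆ Q → pick Q ≡ pick R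
      pick-cong {Q} {R} Q⊆R R⊆Q with em {P = ∃ Q} | em {P = ∃ R}
      ... | yes q       | yes r       =
        least-unique Q⊆R R⊆Q (proj₂ (least-exists q)) (proj₂ (least-exists r))
      ... | yes (α , q) | no ¬r       = contradiction (α , Q⊆R q) ¬r
      ... | no ¬q       | yes (α , r) = contradiction (α , R⊆Q r) ¬q
      ... | no _        | no _        = refl

      pick-sound : ∀ {Q} → ∃ Q → Q (pick Q)
      pick-sound {Q} q with em {P = ∃ Q}
      ... | yes q′ = proj₁ (proj₂ (least-exists q′))
      ... | no ¬q  = contradiction q ¬q

      next : ∀ w → WfRec _≺_ (λ _ → Carrier) w → Carrier
      next w values = pick (Fresh w values)

      next-cong : ∀ w {f g : WfRec _≺_ (λ _ → Carrier) w} →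
                  (∀ {v} v≺w → f {v} v≺w ≡ g v≺w) → next w f ≡ next w g
      next-cong w f≡g = pick-cong
        (λ (p , fresh) → p , λ v≺w d eq → fresh v≺w d (trans (f≡g v≺w) eq))
        (λ (p , fresh) → p , λ v≺w d eq → fresh v≺w d (trans (sym (f≡g v≺w)) eq))

      F : W → Carrier
      F = All.wfRec ≺-wellFounded 0ℓ (λ _ → Carrier) next

      F-unfold : ∀ w → F w ≡ next w (λ {v} _ → F v)
      F-unfold w = FixPoint.unfold-wfRec ≺-wellFounded (λ _ → Carrier) next next-cong

      module _ (room : ∀ {w} → D w → ¬ (P ≲ (λ v → D v × v ≺ w))) where

        -- If every ordinal in `P` were already used, choosing for each an earlier argument with
        -- that value would inject `P` into the segment below `w`, against `room`.
        fresh-exists : ∀ {w} → D w → ∃ (Fresh w (λ {v} _ → F v))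
        fresh-exists {w} d = by-contradiction λ none → room d record
          { to        = used
          ; into      = λ p → let v∈ , _ = used-spec (hit none p) in v∈
          ; injective = λ p q eq →
              trans (sym (proj₂ (used-spec (hit none p))))
                    (trans (cong F eq) (proj₂ (used-spec (hit none q))))
          }
          where
          Hit : Carrier → Set
          Hit α = ∃ λ v → (D v × v ≺ w) × F v ≡ α

          hit : ¬ ∃ (Fresh w (λ {v} _ → F v)) → ∀ {α} → P α → Hit α
          hit none p = by-contradiction λ ¬hit →
            none (_ , p , λ v≺w dv eq → ¬hit (_ , (dv , v≺w) , eq))

          used : Carrier → W
          used α with em {P = Hit α}
          ... | yes (v , _) = v
          ... | no _        = w

          used-spec : ∀ {α} → Hit α → (D (used α) × used α ≺ w) × F (used α) ≡ α
          used-spec {α} h with em {P = Hit α}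
          ... | yes (_ , spec) = spec
          ... | no ¬h          = contradiction h ¬h

        F-fresh : ∀ {w} → D w → Fresh w (λ {v} _ → F v) (F w)
        F-fresh {w} d =
          subst (Fresh w _) (sym (F-unfold w)) (pick-sound (fresh-exists d))

        greedy : D ≲ P
        greedy = record { to = F ; into = λ d → proj₁ (F-fresh d) ; injective = inj }
          where
          inj : ∀ {v w} → D v → D w → F v ≡ F w → v ≡ w
          inj {v} {w} dv dw eq with ≺-compare v w
          ... | tri< v≺w _ _ = contradiction eq (proj₂ (F-fresh dw) v≺w dv)
          ... | tri≈ _ v≡w _ = v≡w
          ... | tri> _ _ w≺v = contradiction (sym eq) (proj₂ (F-fresh dv) w≺v dw)

    -- Hessenberg's theorem.

    Upto : Carrier → Pred Carrier 0ℓ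
    Upto α β = β ≤ α

    -- The code of the new top element is zero and all other codes are shifted by one.
    upto-countable : ∀ {α} → IsCountable (Below α) → IsCountable (Upto α)
    upto-countable {α} f = record { to = g ; into = λ _ → tt ; injective = inj }
      where
      g : Carrier → ℕ
      g β with compare β α
      ... | tri< _ _ _ = suc (to f β)
      ... | tri≈ _ _ _ = zero
      ... | tri> _ _ _ = zero

      inj : ∀ {β γ} → β ≤ α → γ ≤ α → g β ≡ g γ → β ≡ γ
      inj {β} {γ} β≤α γ≤α eq with compare β α | compare γ α
      ... | tri< β<α _ _ | tri< γ<α _ _  = injective f β<α γ<α (ℕ.suc-injective eq)
      ... | tri≈ _ β≡α _ | tri≈ _ γ≡α _  = trans β≡α (sym γ≡α)
      ... | tri> _ _ β>α | _             = contradiction β>α (≤⇒≯ β≤α)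
      ... | _            | tri> _ _ γ>α  = contradiction γ>α (≤⇒≯ γ≤α)
      inj {β} {γ} β≤α γ≤α () | tri< _ _ _ | tri≈ _ _ _
      inj {β} {γ} β≤α γ≤α () | tri≈ _ _ _ | tri< _ _ _

    -- Otherwise a constant map would be injective on `P`.
    uncountable⇒distinct : {P : Pred Carrier 0ℓ} → ¬ IsCountable P →
                           ∃ λ α → ∃ λ β → P α × P β × α ≢ β
    uncountable⇒distinct ¬countable = by-contradiction λ none → ¬countable record
      { to        = λ _ → zero
      ; into      = λ _ → tt
      ; injective = λ p q _ → by-contradiction λ α≢β → none (_ , _ , p , q , α≢β)
      }

    -- Two elements `u` and `v` below `α` serve as tags: the square has room for a copy of the
    -- segment tagged `u` and one extra pair for `α`.
    upto≲below : ∀ {α} → ¬ IsCountable (Below α) → HasSquareInjection (Below α) →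
                 Upto α ≲ Below α
    upto≲below {α} ¬countable sq with uncountable⇒distinct ¬countable
    ... | u , v , u<α , v<α , u≢v = ≲-trans embed sq
      where
      g : Carrier → Carrier × Carrier
      g β with compare β α
      ... | tri< _ _ _ = u , β
      ... | tri≈ _ _ _ = v , v
      ... | tri> _ _ _ = v , v

      g-into : ∀ {β} → β ≤ α → (Below α ⟨×⟩ Below α) (g β)
      g-into {β} β≤α with compare β α
      ... | tri< β<α _ _ = u<α , β<α
      ... | tri≈ _ _ _   = v<α , v<α
      ... | tri> _ _ _   = v<α , v<α

      inj : ∀ {β γ} → β ≤ α → γ ≤ α → g β ≡ g γ → β ≡ γ
      inj {β} {γ} β≤α γ≤α eq with compare β α | compare γ α
      ... | tri< _ _ _   | tri< _ _ _    = ,-injectiveʳ eq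
      ... | tri≈ _ β≡α _ | tri≈ _ γ≡α _  = trans β≡α (sym γ≡α)
      ... | tri< _ _ _   | tri≈ _ _ _    = contradiction (,-injectiveˡ eq) u≢v
      ... | tri≈ _ _ _   | tri< _ _ _    = contradiction (sym (,-injectiveˡ eq)) u≢v
      ... | tri> _ _ β>α | _             = contradiction β>α (≤⇒≯ β≤α)
      ... | _            | tri> _ _ γ>α  = contradiction γ>α (≤⇒≯ γ≤α)

      embed : Upto α ≲ (Below α ⟨×⟩ Below α)
      embed = record { to = g ; into = g-into ; injective = inj }

    private
      module Gödel where
        _<₂_ : Rel (Carrier × Carrier) 0ℓ
        _<₂_ = Lex.×-Lex _≡_ _<_ _<_

        key : Carrier × Carrier → Carrier × (Carrier × Carrier)
        key (α , β) = α ⊔ₒ β , α , β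

        _≺_ : Rel (Carrier × Carrier) 0ℓ
        _≺_ = Lex.×-Lex _≡_ _<_ _<₂_ on key

        ≺-wellFounded : WellFounded _≺_
        ≺-wellFounded = On.wellFounded key
          (Lex.×-wellFounded wellFounded (Lex.×-wellFounded wellFounded wellFounded))

        ≺-compare : Trichotomous _≡_ _≺_
        ≺-compare v w with Lex.×-compare sym compare (Lex.×-compare sym compare compare) (key v) (key w)
        ... | tri< v≺w v≉w w⊀v = tri< v≺w (λ { refl → v≉w (refl , refl , refl) }) w⊀v
        ... | tri≈ v⊀w (_ , p , q) w⊀v = tri≈ v⊀w (cong₂ _,_ p q) w⊀v
        ... | tri> v⊀w v≉w w≺v = tri> v⊀w (λ { refl → v≉w (refl , refl , refl) }) w≺v

        ≺⇒⊔≤ : ∀ {v w} → v ≺ w → proj₁ (key v) ≤ proj₁ (key w)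
        ≺⇒⊔≤ (inj₁ lt)       = inj₁ lt
        ≺⇒⊔≤ (inj₂ (eq , _)) = inj₂ eq

    -- Hessenberg's theorem for initial P: in the order of pairs by maximum,
    -- then lexicographically, the pairs below w lie in the square of
    -- Upto (max w), which is too small to exhaust P.
    square-initial : (P : Pred Carrier 0ℓ) →
      (∀ {α} → P α → IsCountable (Below α) ⊎ HasSquareInjection (Below α)) →
      (∀ {α} → P α → ¬ (P ≲ Below α)) →
      ¬ IsCountable P → HasSquareInjection P
    square-initial P segments initialP ¬countable =
      Greedy.greedy ≺-wellFounded ≺-compare (proj₁ (uncountable⇒distinct ¬countable)) (P ⟨×⟩ P) P room
      where
      open Gödel

      -- If `Below γ` is countable, so is the square of `Upto γ`, and then `P` would be countable.
      -- Otherwise that square injects into `Below γ`, against `initialP`.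
      too-small : ∀ {γ} → P γ → ¬ (P ≲ (Upto γ ⟨×⟩ Upto γ))
      too-small {γ} pγ f with em {P = IsCountable (Below γ)} | segments pγ
      ... | yes cnt | _       =
        ¬countable (≲-trans f (≲-trans (⟨×⟩-mono-≲ (upto-countable cnt)) ℕ-square))
      ... | no ¬cnt | inj₁ cnt = contradiction cnt ¬cnt
      ... | no ¬cnt | inj₂ sq  =
        initialP pγ (≲-trans f (≲-trans (⟨×⟩-mono-≲ (upto≲below ¬cnt sq)) sq))

      ⊔-closed : ∀ {α β} → P α → P β → P (α ⊔ₒ β)
      ⊔-closed {α} {β} pα pβ with compare α β
      ... | tri< _ _ _ = pβ
      ... | tri≈ _ _ _ = pβ
      ... | tri> _ _ _ = pα

      room : ∀ {w} → (P ⟨×⟩ P) w → ¬ (P ≲ (λ v → (P ⟨×⟩ P) v × v ≺ w))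
      room {w} (pα , pβ) f = too-small (⊔-closed pα pβ) (≲-trans f (⊆⇒≲ λ {v} (_ , v≺w) →
          ≤-trans (α≤α⊔β (proj₁ v) (proj₂ v)) (≺⇒⊔≤ {v} {w} v≺w)
        , ≤-trans (β≤α⊔β (proj₁ v) (proj₂ v)) (≺⇒⊔≤ {v} {w} v≺w)))

    -- By induction: an uncountable segment that injects into a smaller one inherits its square
    -- injection; one that does not satisfies `square-initial`. The countable alternative takes care
    -- of finite segments, whose squares are in general too large.
    below-square : ∀ α → IsCountable (Below α) ⊎ HasSquareInjection (Below α)
    below-square = All.wfRec wellFounded 0ℓ _ go
      where
      Claim : Pred Carrier 0ℓ
      Claim α = IsCountable (Below α) ⊎ HasSquareInjection (Below α)

      go : ∀ α → WfRec _<_ Claim α → Claim α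
      go α rec with em {P = ∃ λ β → β < α × Below α ≲ Below β} | em {P = IsCountable (Below α)}
      ... | _                 | yes cnt = inj₁ cnt
      ... | no ¬smaller       | no ¬cnt =
        inj₂ (square-initial (Below α) rec (λ β<α f → ¬smaller (_ , β<α , f)) ¬cnt)
      ... | yes (β , β<α , f) | no ¬cnt with rec β<α
      ...   | inj₁ cnt = contradiction (≲-trans f cnt) ¬cnt
      ...   | inj₂ sq  = inj₂ (≲-trans (⟨×⟩-mono-≲ f) (≲-trans sq (⊆⇒≲ λ γ<β → <-trans γ<β β<α)))

    uncountable⇒¬countable : Uncountable (setoid Carrier) → ¬ IsCountable (U {A = Carrier})
    uncountable⇒¬countable unc f =
      unc record { to = to f ; cong = cong (to f) ; injective = injective f tt tt }

    distinct-elements : Uncountable (setoid Carrier) → ∃ λ α → ∃ λ β → α ≢ β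
    distinct-elements unc =
      let α , β , _ , _ , α≢β = uncountable⇒distinct (uncountable⇒¬countable unc) in α , β , α≢β

    abstract
      square : Uncountable (setoid Carrier) → HasSquareInjection (U {A = Carrier})
      -- An injection of the whole cardinal into a proper segment would be a bijection by
      -- Cantor-Bernstein, which `initial` excludes.
      square unc = square-initial U (λ _ → below-square _) (λ {α} _ f → initial α (bij f))
                     (uncountable⇒¬countable unc)
        where
        bij : ∀ {α} → U {A = Carrier} ≲ Below α → subset (Below α) ≈ᶜ setoid Carrier
        bij f = CantorBernstein.bijection
          (record { to = proj₁ ; cong = id ; injective = id })
          (record { to        = λ β → to f β , into f tt
                  ; cong      = cong (to f)
                  ; injective = injective f tt tt })

-- Sums modulo 2 over lists.

xor-involutive : ∀ x y → x xor (x xor y) ≡ y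
xor-involutive x y = trans (sym (xor-assoc x x y)) (cong (_xor y) (xor-same x))

xor-swap : ∀ x y z → x xor (y xor z) ≡ y xor (x xor z)
xor-swap x y z =
  trans (sym (xor-assoc x y z)) (trans (cong (_xor z) (xor-comm x y)) (xor-assoc y x z))

parity : (I → Bool) → List I → Bool
parity m = foldr (λ i → m i xor_) false

parity-↭ : (m : I → Bool) {is js : List I} → is ↭ js → parity m is ≡ parity m js
parity-↭ m ↭-refl        = refl
parity-↭ m (prep i p)    = cong (m i xor_) (parity-↭ m p)
parity-↭ m (swap i j p)  =
  trans (xor-swap (m i) (m j) _) (cong (λ b → m j xor (m i xor b)) (parity-↭ m p))
parity-↭ m (↭-trans p q) = trans (parity-↭ m p) (parity-↭ m q)

parity-witness : (m : I → Bool) (is : List I) → parity m is ≡ true → ∃ λ i → i ∈ is × m i ≡ true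
parity-witness m (i ∷ is) odd with m i in eq
... | true  = i , here refl , eq
... | false = let j , j∈is , mj = parity-witness m is odd in j , there j∈is , mj

∈⇒↭ : {i : I} {is : List I} → i ∈ is → ∃ λ js → is ↭ i ∷ js
∈⇒↭ i∈is with ∈-∃++ i∈is
... | ys , zs , refl = _ , shift _ ys zs

-- Heights of nodes in a tree.

module BranchSums (em : ∀ {ℓ} → ExcludedMiddle ℓ) where
  open Classical em

  ⟦_⟧ : Set ℓ → Bool
  ⟦ P ⟧ = does (em {P = P})

  ⟦⟧-true : {P : Set ℓ} → P → ⟦ P ⟧ ≡ true
  ⟦⟧-true = dec-true em

  ⟦⟧-witness : {P : Set ℓ} → ⟦ P ⟧ ≡ true → P
  ⟦⟧-witness {P = P} eq with em {P = P}
  ⟦⟧-witness _  | yes p = p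
  ⟦⟧-witness () | no _

  ⟦⟧-cong : {P Q : Set ℓ} → (P → Q) → (Q → P) → ⟦ P ⟧ ≡ ⟦ Q ⟧
  ⟦⟧-cong P⇒Q Q⇒P = does-⇔ (mk⇔ P⇒Q Q⇒P) em em

  module _ (κ : Cardinal) where
    open WellOrdered κ

    -- f⁻¹ followed by g would map the ordinals below α strictly increasingly
    -- into β, which is impossible when β < α.
    no-compression : {X : Set} {_≺_ : Rel X 0ℓ} {P : Pred X 0ℓ} {α β : Carrier}
      (f g : ∀ x → P x → Carrier) →
      (∀ {γ} → γ < α → ∃ λ x → Σ[ p ∈ P x ] f x p ≡ γ) →
      (∀ {x y p q} → f x p < f y q → x ≺ y) →
      (∀ {x y p q} → x ≺ y → g x p < g y q) →
      (∀ {x p} → g x p < β) →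
      ¬ (β < α)
    no-compression {P = P} {α} {β} f g f-surjective f-cancel g-mono g<β β<α
      with f-surjective β<α
    ... | x , p , refl = All.wfRec wellFounded 0ℓ _ increasing _ x p refl g<β
      where
      increasing : ∀ γ → WfRec _<_ (λ γ → ∀ x p → f x p ≡ γ → ¬ (g x p < γ)) γ →
                   ∀ x p → f x p ≡ γ → ¬ (g x p < γ)
      -- Infinite descent: the `y` that `f` sends to the value of `g` at `x` lies before `x`, and
      -- `g` lowers it again.
      increasing _ rec x p refl gx<fx with f-surjective (<-trans (g<β {x} {p}) β<α)
      ... | y , q , fy≡gx = rec gx<fx y q fy≡gx
        (g-mono (f-cancel (subst (_< f x p) (sym fy≡gx) gx<fx)))

  module Rank (T : Tree) (κ : Cardinal) (height : HasHeight T κ) where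
    open Tree T public using (Node) renaming (_<_ to _⊏_)
    open Tree T using (isStrictPartialOrder; predecessors-wellOrdered)
    open IsStrictPartialOrder isStrictPartialOrder using () renaming (trans to ⊏-trans)
    open NonStrict _≡_ _⊏_ public using () renaming (_≤_ to _⊑_)
    open WellOrdered κ
    open HasHeight height

    ⊑-refl : ∀ {s} → s ⊑ s
    ⊑-refl = inj₂ refl

    ⊑-trans : ∀ {s t u} → s ⊑ t → t ⊑ u → s ⊑ u
    ⊑-trans = NonStrict.trans _≡_ _⊏_ isEquivalence (resp₂ _⊏_) ⊏-trans

    ρ : Node → Carrier
    ρ t = proj₁ (bounded t)

    private
      module Iso (t : Node) where
        fun : Σ Node (_⊏ t) → Σ Carrier (Below (ρ t))
        fun = proj₁ (proj₂ (bounded t))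
        open IsOrderIsomorphism (proj₂ (proj₂ (bounded t))) public
          renaming (cong to fun-cong)

    -- The isomorphism for `t`, restricted to the predecessors of `s`, maps onto the ordinals below
    -- the image of `s`. Comparing it with the isomorphism for `s`, `no-compression` rules out both
    -- strict inequalities.
    ρ-unique : ∀ {s t} (s⊏t : s ⊏ t) → ρ s ≡ proj₁ (Iso.fun t (s , s⊏t))
    ρ-unique {s} {t} s⊏t with compare (ρ s) (proj₁ (Iso.fun t (s , s⊏t)))
    ... | tri≈ _ eq _ = eq
    ... | tri< ρs<β _ _ = contradiction ρs<β
      (no-compression κ {_≺_ = _⊏_} {P = _⊏ s} throughT throughS surjective
         (λ {_} {_} {p} {q} → T.cancel {_ , ⊏-trans p s⊏t} {_ , ⊏-trans q s⊏t})
         (λ {_} {_} {p} {q} → S.mono {_ , p} {_ , q})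
         (λ {_} {p} → proj₂ (S.fun (_ , p))))
      where
      module S = Iso s
      module T = Iso t
      throughS throughT : ∀ u → u ⊏ s → Carrier
      throughS u u⊏s = proj₁ (S.fun (u , u⊏s))
      throughT u u⊏s = proj₁ (T.fun (u , ⊏-trans u⊏s s⊏t))
      surjective : ∀ {γ} → γ < proj₁ (T.fun (s , s⊏t)) → ∃ λ u → Σ[ u⊏s ∈ u ⊏ s ] throughT u u⊏s ≡ γ
      surjective {γ} γ<β with T.surjective (γ , <-trans γ<β (proj₂ (T.fun (s , s⊏t))))
      ... | (u , u⊏t) , hits =
        u , T.cancel {u , u⊏t} {s , s⊏t} (subst (_< _) (sym (hits refl)) γ<β) , hits refl
    ... | tri> _ _ β<ρs = contradiction β<ρs
      (no-compression κ {_≺_ = _⊏_} {P = _⊏ s} throughS throughT surjective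
         (λ {_} {_} {p} {q} → S.cancel {_ , p} {_ , q})
         (λ {_} {_} {p} {q} → T.mono {_ , ⊏-trans p s⊏t} {_ , ⊏-trans q s⊏t})
         (λ {_} {p} → T.mono {_ , ⊏-trans p s⊏t} {s , s⊏t} p))
      where
      module S = Iso s
      module T = Iso t
      throughS throughT : ∀ u → u ⊏ s → Carrier
      throughS u u⊏s = proj₁ (S.fun (u , u⊏s))
      throughT u u⊏s = proj₁ (T.fun (u , ⊏-trans u⊏s s⊏t))
      surjective : ∀ {γ} → γ < ρ s → ∃ λ u → Σ[ u⊏s ∈ u ⊏ s ] throughS u u⊏s ≡ γ
      surjective {γ} γ<ρs with S.surjective (γ , γ<ρs)
      ... | (u , u⊏s) , hits = u , u⊏s , hits refl

    ρ-mono-< : ∀ {s t} → s ⊏ t → ρ s < ρ t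
    ρ-mono-< {s} {t} s⊏t = subst (_< ρ t) (sym (ρ-unique s⊏t)) (proj₂ (Iso.fun t (s , s⊏t)))

    ρ-mono : ∀ {s t} → s ⊑ t → ρ s ≤ ρ t
    ρ-mono (inj₁ s⊏t)  = inj₁ (ρ-mono-< s⊏t)
    ρ-mono (inj₂ refl) = ≤-refl

    -- The ancestor of `t` at level `α`: the projection between the groups, on a single node.
    restriction : ∀ {α t} → α ≤ ρ t → ∃ λ s → s ⊑ t × ρ s ≡ α
    restriction {t = t} (inj₂ refl) = t , ⊑-refl , refl
    restriction {α} {t} (inj₁ α<ρt) with Iso.surjective t (α , α<ρt)
    ... | (s , s⊏t) , hits = s , inj₁ s⊏t , trans (ρ-unique s⊏t) (hits refl)

    comparable : ∀ {s t u} → s ⊑ u → t ⊑ u → s ⊏ t ⊎ s ≡ t ⊎ t ⊏ s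
    comparable (inj₂ refl) (inj₂ refl) = inj₂ (inj₁ refl)
    comparable (inj₂ refl) (inj₁ t⊏u)  = inj₂ (inj₂ t⊏u)
    comparable (inj₁ s⊏u)  (inj₂ refl) = inj₁ s⊏u
    comparable {u = u} (inj₁ s⊏u) (inj₁ t⊏u)
      with IsWellOrder.compare (predecessors-wellOrdered u) (_ , s⊏u) (_ , t⊏u)
    ... | tri< s⊏t _ _ = inj₁ s⊏t
    ... | tri≈ _ s≡t _ = inj₂ (inj₁ s≡t)
    ... | tri> _ _ t⊏s = inj₂ (inj₂ t⊏s)

    comparable⇒⊑ : ∀ {s t} → s ⊏ t ⊎ s ≡ t ⊎ t ⊏ s → ρ s ≤ ρ t → s ⊑ t
    comparable⇒⊑ (inj₁ s⊏t)        _     = inj₁ s⊏t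
    comparable⇒⊑ (inj₂ (inj₁ s≡t)) _     = inj₂ s≡t
    comparable⇒⊑ (inj₂ (inj₂ t⊏s)) ρs≤ρt = contradiction (ρ-mono-< t⊏s) (≤⇒≯ ρs≤ρt)

    ⊑-bounded : ∀ {s t u} → s ⊑ u → t ⊑ u → ρ s ≤ ρ t → s ⊑ t
    ⊑-bounded s⊑u t⊑u = comparable⇒⊑ (comparable s⊑u t⊑u)

    -- Cofinal branches and the regularity of ω₁.

    Cofinal : Pred Node 0ℓ → Set
    Cofinal B = ∀ α → ∃ λ t → B t × α ≤ ρ t

    DownClosed : Pred Node 0ℓ → Set
    DownClosed B = ∀ {s t} → s ⊑ t → B t → B s

    -- Adding a predecessor `s` of a member to `B` leaves a chain, so maximality puts `s` in `B`.
    branch-downClosed : ∀ {B} → IsBranch T B → DownClosed B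
    branch-downClosed {B} isBranch {s} {t} s⊑t t∈B = maximal {B+s} chain inj₁ (inj₂ refl)
      where
      open IsBranch isBranch
      B+s : Pred Node 0ℓ
      B+s x = B x ⊎ x ≡ s

      with-s : ∀ {x} → B x → x ⊏ s ⊎ x ≡ s ⊎ s ⊏ x
      with-s x∈B with isChain x∈B t∈B
      ... | inj₁ x⊏t         = comparable (inj₁ x⊏t) s⊑t
      ... | inj₂ (inj₁ refl) = comparable ⊑-refl s⊑t
      ... | inj₂ (inj₂ t⊏x)  = comparable ⊑-refl (⊑-trans s⊑t (inj₁ t⊏x))

      chain : IsChain T B+s
      chain (inj₁ x∈B)  (inj₁ y∈B)  = isChain x∈B y∈B
      chain (inj₁ x∈B)  (inj₂ refl) = with-s x∈B
      chain (inj₂ refl) (inj₂ refl) = inj₂ (inj₁ refl)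
      chain (inj₂ refl) (inj₁ y∈B)  with with-s y∈B
      ... | inj₁ y⊏s        = inj₂ (inj₂ y⊏s)
      ... | inj₂ (inj₁ y≡s) = inj₂ (inj₁ (sym y≡s))
      ... | inj₂ (inj₂ s⊏y) = inj₁ s⊏y

    -- A node of a larger chain is comparable with a member of `B` of at least its height, hence
    -- lies below that member.
    cofinal⇒branch : ∀ {B} → IsChain T B → DownClosed B → Cofinal B → IsBranch T B
    cofinal⇒branch {B} chain down cofinal = record { isChain = chain ; maximal = maximal }
      where
      maximal : ∀ {C : Pred Node 0ℓ} → IsChain T C → B ⊆ C → C ⊆ B
      maximal chainC B⊆C {x} x∈C with cofinal (ρ x)
      ... | t , t∈B , ρx≤ρt = down (comparable⇒⊑ (chainC x∈C (B⊆C t∈B)) ρx≤ρt) t∈B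

    module Omega₁ (isOmega₁ : IsOmega₁ κ) where
      open IsOmega₁ isOmega₁

      segment-countable : ∀ α → IsCountable (Below α)
      segment-countable α = ≤ᶜ⇒≲ zero (least α)

      -- Given a cofinal `r`, an ordinal `α` would be coded by the number of an index `j` with
      -- `α ≤ r j` and the number of `α` in the countable set `Upto (r j)`, making ω₁ countable.
      regular : {J : Set} {P : Pred J 0ℓ} (r : J → Carrier) →
                IsCountable P → ¬ (∀ α → ∃ λ j → P j × α ≤ r j)
      regular r cnt cofinal = uncountable record
        { to = enumerate ; cong = cong enumerate ; injective = inj _ _ }
        where
        code : ∀ β → IsCountable (Upto β)
        code β = upto-countable (segment-countable β)

        enumerate : Carrier → ℕ
        enumerate α = let j , _ = cofinal α in pairℕ (to cnt j) (to (code (r j)) α)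

        code-injective : ∀ {i j α β} → i ≡ j → α ≤ r i → β ≤ r j →
                         to (code (r i)) α ≡ to (code (r j)) β → α ≡ β
        code-injective refl = injective (code _)

        inj : ∀ α β → enumerate α ≡ enumerate β → α ≡ β
        inj α β eq with cofinal α | cofinal β
        ... | i , pi , α≤ri | j , pj , β≤rj =
          let eq′ = pairℕ-injective (to cnt i) _ (to cnt j) _ eq
          in code-injective (injective cnt pi pj (,-injectiveˡ eq′)) α≤ri β≤rj (,-injectiveʳ eq′)

      bounded-sequence : (α : ℕ → Carrier) → ∃ λ β → ∀ n → α n ≤ β
      bounded-sequence α = by-contradiction λ unbounded → regular α (⊆⇒≲ {P = U} id) λ β →
        by-contradiction λ none → unbounded (β , λ n →
          ≮⇒≥ λ β<αn → none (n , tt , inj₁ β<αn))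

      -- Heights are injective on a chain, so a chain staying below level `α` is as countable as the
      -- segment below `α`.
      uncountable⇒cofinal : ∀ {B} → IsChain T B → Uncountable (subset B) → Cofinal B
      uncountable⇒cofinal {B} chain unc α = by-contradiction λ none →
        let below : ∀ {t} → B t → ρ t < α
            below t∈B = by-contradiction λ ρt≮α → none (_ , t∈B , ≮⇒≥ ρt≮α)
            open Injection (least α) using () renaming (to to fun; injective to fun-injective)
        in unc record
          { to        = λ (t , t∈B) → fun (ρ t , below t∈B)
          ; cong      = λ eq → Injection.cong (least α) (cong ρ eq)
          ; injective = λ {(s , s∈B)} {(t , t∈B)} eq → ρ-injective s∈B t∈B (fun-injective eq)
          }
        where
        ρ-injective : ∀ {s t} → B s → B t → ρ s ≡ ρ t → s ≡ t
        ρ-injective s∈B t∈B eq with chain s∈B t∈B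
        ... | inj₁ s⊏t        = contradiction (ρ-mono-< s⊏t) (irrefl eq)
        ... | inj₂ (inj₁ s≡t) = s≡t
        ... | inj₂ (inj₂ t⊏s) = contradiction (ρ-mono-< t⊏s) (irrefl (sym eq))

      cofinal⇒uncountable : ∀ {B} → Cofinal B → Uncountable (subset B)
      cofinal⇒uncountable cofinal cnt = regular ρ (≤ᶜ⇒≲ zero cnt) cofinal

    -- Finite representations, and subtracting a branch.

    value : List Node → Node → Bool
    value c s = parity (λ t → ⟦ s ⊑ t ⟧) c

    value-↭ : ∀ s {c d} → c ↭ d → value c s ≡ value d s
    value-↭ s = parity-↭ (λ t → ⟦ s ⊑ t ⟧)

    -- On the nodes of height at most α, h is the sum modulo 2 of the indicators of
    -- the predecessor sets of nodes at or beyond level α.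
    record Represents (h : Node → Bool) (α : Carrier) (c : List Node) : Set where
      field
        high   : ∀ {t} → t ∈ c → α ≤ ρ t
        agrees : ∀ {s} → ρ s ≤ α → h s ≡ value c s

    open Represents

    Representable : (Node → Bool) → ℕ → Carrier → Set
    Representable h n α = ∃ λ c → length c ℕ.≤ n × Represents h α c

    represents-≤ : ∀ {h α β c} → α ≤ β → Represents h β c → Represents h α c
    represents-≤ α≤β rep = record
      { high   = λ t∈c → ≤-trans α≤β (high rep t∈c)
      ; agrees = λ ρs≤α → agrees rep (≤-trans ρs≤α α≤β)
      }

    representable-≤ : ∀ {h n α β} → α ≤ β → Representable h n β → Representable h n α
    representable-≤ α≤β (c , short , rep) = c , short , represents-≤ α≤β rep

    -- If n + 1 nodes are needed at α₀, then the representing nodes above a node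
    -- of height at least α₀ are unique, so that those above a fixed node s₀ at
    -- α₀ trace out a cofinal branch; subtracting it saves one node.
    module Peel {h : Node → Bool} {n : ℕ} (small : ∀ α → Representable h (suc n) α)
                {α₀ : Carrier} (needed : ¬ Representable h n α₀) where

      -- Two members above the same `s` have the same predecessors up to level `α₀`, so they cancel
      -- modulo 2. Deleting both leaves a list short enough to contradict `needed`.
      uncrowded : ∀ {α c c′ s t t′} → α₀ ≤ α → Represents h α c → length c ℕ.≤ suc n →
                  c ↭ t ∷ c′ → t′ ∈ c′ → α₀ ≤ ρ s → s ⊑ t → s ⊑ t′ → ⊥
      uncrowded {α} {c} {c′} {s} {t} {t′} α₀≤α rep short c↭ t′∈c′ α₀≤ρs s⊑t s⊑t′
        with ∈⇒↭ t′∈c′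
      ... | d , c′↭ = needed (d , d-short , record { high = d-high ; agrees = d-agrees })
        where
        c↭tt′d : c ↭ t ∷ t′ ∷ d
        c↭tt′d = ↭-trans c↭ (prep t c′↭)

        d-short : length d ℕ.≤ n
        d-short = ℕ.≤-trans (ℕ.n≤1+n _)
          (ℕ.s≤s⁻¹ (subst (ℕ._≤ suc n) (↭-length c↭tt′d) short))

        d-high : ∀ {u} → u ∈ d → α₀ ≤ ρ u
        d-high u∈d = ≤-trans α₀≤α (high rep (∈-resp-↭ (↭-sym c↭tt′d) (there (there u∈d))))

        same : ∀ {x} → ρ x ≤ α₀ → ⟦ x ⊑ t ⟧ ≡ ⟦ x ⊑ t′ ⟧
        same ρx≤α₀ = ⟦⟧-cong
          (λ x⊑t → ⊑-trans (⊑-bounded x⊑t s⊑t (≤-trans ρx≤α₀ α₀≤ρs)) s⊑t′)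
          (λ x⊑t′ → ⊑-trans (⊑-bounded x⊑t′ s⊑t′ (≤-trans ρx≤α₀ α₀≤ρs)) s⊑t)

        d-agrees : ∀ {x} → ρ x ≤ α₀ → h x ≡ value d x
        d-agrees {x} ρx≤α₀ = begin
          h x                                     ≡⟨ agrees rep (≤-trans ρx≤α₀ α₀≤α) ⟩
          value c x                               ≡⟨ value-↭ x c↭tt′d ⟩
          ⟦ x ⊑ t ⟧ xor (⟦ x ⊑ t′ ⟧ xor value d x) ≡⟨ cong (_xor (⟦ x ⊑ t′ ⟧ xor value d x)) (same ρx≤α₀) ⟩
          ⟦ x ⊑ t′ ⟧ xor (⟦ x ⊑ t′ ⟧ xor value d x) ≡⟨ xor-involutive ⟦ x ⊑ t′ ⟧ _ ⟩
          value d x                               ∎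
          where open ≡-Reasoning

      -- By `uncrowded`, `t` is the only member of `c` above `s`, so the sum at `s` has a single
      -- nonzero term.
      on-support : ∀ {α c s t} → α₀ ≤ α → Represents h α c → length c ℕ.≤ suc n →
                   t ∈ c → s ⊑ t → ρ s ≡ α → h s ≡ true
      on-support {α} {c} {s} {t} α₀≤α rep short t∈c s⊑t refl with ∈⇒↭ t∈c
      ... | c′ , c↭ = begin
        h s                      ≡⟨ agrees rep ≤-refl ⟩
        value c s                ≡⟨ value-↭ s c↭ ⟩
        ⟦ s ⊑ t ⟧ xor value c′ s ≡⟨ cong₂ _xor_ (⟦⟧-true s⊑t) rest ⟩
        true                     ∎
        where
        open ≡-Reasoning
        rest : value c′ s ≡ false
        rest with value c′ s in eq
        ... | false = refl
        ... | true  with parity-witness _ c′ eq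
        ...   | t′ , t′∈c′ , s⊑t′ =
          ⊥-elim (uncrowded α₀≤α rep short c↭ t′∈c′ α₀≤α s⊑t (⟦⟧-witness s⊑t′))

      -- The list at `α₀` is not empty, since the empty list would contradict `needed`; the ancestor
      -- of its first member at `α₀` lies in the support.
      seed : ∃ λ s₀ → ρ s₀ ≡ α₀ × h s₀ ≡ true
      seed with small α₀
      ... | []    , _     , rep = contradiction ([] , ℕ.z≤n , rep) needed
      ... | t ∷ c , short , rep with restriction (high rep (here refl))
      ...   | s , s⊑t , ρs≡α₀ = s , ρs≡α₀ , on-support ≤-refl rep short (here refl) s⊑t ρs≡α₀

      s₀ : Node
      s₀ = proj₁ seed

      α₀≤ρ : ∀ {s} → s₀ ⊑ s → α₀ ≤ ρ s
      α₀≤ρ {s} s₀⊑s = subst (_≤ ρ s) (proj₁ (proj₂ seed)) (ρ-mono s₀⊑s)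

      -- At a level above both nodes each has a member of the representing list beyond it. These
      -- members both extend `s₀`, so `uncrowded` makes them the same list entry.
      directed : ∀ {s s′} → s₀ ⊑ s → h s ≡ true → s₀ ⊑ s′ → h s′ ≡ true → ∃ λ t → s ⊑ t × s′ ⊑ t
      directed {s} {s′} s₀⊑s hs s₀⊑s′ hs′ with small (ρ s ⊔ₒ ρ s′)
      ... | c , short , rep
        with parity-witness _ c (trans (sym (agrees rep (α≤α⊔β (ρ s) (ρ s′)))) hs)
           | parity-witness _ c (trans (sym (agrees rep (β≤α⊔β (ρ s) (ρ s′)))) hs′)
      ...   | t , t∈c , s⊑t | t′ , t′∈c , s′⊑t′ with ∈⇒↭ t∈c
      ...     | c′ , c↭ with ∈-resp-↭ c↭ t′∈c
      ...       | here refl   = t , ⟦⟧-witness s⊑t , ⟦⟧-witness s′⊑t′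
      ...       | there t′∈c′ = ⊥-elim (uncrowded
        (≤-trans (α₀≤ρ s₀⊑s) (α≤α⊔β (ρ s) (ρ s′))) rep short c↭ t′∈c′ (α₀≤ρ ⊑-refl)
        (⊑-trans s₀⊑s (⟦⟧-witness s⊑t)) (⊑-trans s₀⊑s′ (⟦⟧-witness s′⊑t′)))

      Trace : Pred Node 0ℓ
      Trace x = ∃ λ s → x ⊑ s × s₀ ⊑ s × h s ≡ true

      Trace-downClosed : DownClosed Trace
      Trace-downClosed x⊑y (s , y⊑s , rest) = s , ⊑-trans x⊑y y⊑s , rest

      Trace-chain : IsChain T Trace
      Trace-chain (s , x⊑s , s₀⊑s , hs) (s′ , y⊑s′ , s₀⊑s′ , hs′) with directed s₀⊑s hs s₀⊑s′ hs′
      ... | t , s⊑t , s′⊑t = comparable (⊑-trans x⊑s s⊑t) (⊑-trans y⊑s′ s′⊑t)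

      -- The coefficient one at `s₀` forces a member `t` of the list at level `β` to extend `s₀`;
      -- the ancestor of `t` at `β` continues the branch.
      follow : ∀ α → ∃ λ β → α ≤ β × α₀ ≤ β × Σ[ (c , _) ∈ Representable h (suc n) β ]
               ∃ λ t → t ∈ c × ∃ λ s → s ⊑ t × ρ s ≡ β × s₀ ⊑ s × h s ≡ true
      follow α with small (α ⊔ₒ α₀)
      ... | c , short , rep with parity-witness _ c (trans (sym (agrees rep ρs₀≤β)) (proj₂ (proj₂ seed)))
        where
        ρs₀≤β : ρ s₀ ≤ α ⊔ₒ α₀
        ρs₀≤β = subst (_≤ α ⊔ₒ α₀) (sym (proj₁ (proj₂ seed))) (β≤α⊔β α α₀)
      ...   | t , t∈c , s₀⊑t with restriction (high rep t∈c)
      ...     | s , s⊑t , ρs≡β =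
        α ⊔ₒ α₀ , α≤α⊔β α α₀ , α₀≤β , (c , short , rep) , t , t∈c , s , s⊑t , ρs≡β
        , ⊑-bounded (⟦⟧-witness s₀⊑t) s⊑t
            (subst₂ _≤_ (sym (proj₁ (proj₂ seed))) (sym ρs≡β) α₀≤β)
        , on-support α₀≤β rep short t∈c s⊑t ρs≡β
        where
        α₀≤β : α₀ ≤ α ⊔ₒ α₀
        α₀≤β = β≤α⊔β α α₀

      Trace-cofinal : Cofinal Trace
      Trace-cofinal α with follow α
      ... | _ , α≤β , _ , _ , _ , _ , s , _ , ρs≡β , s₀⊑s , hs =
        s , (s , ⊑-refl , s₀⊑s , hs) , subst (α ≤_) (sym ρs≡β) α≤β

      -- Up to height `β` the trace is the set of nodes below `t`, so adding it modulo 2 cancels `t`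
      -- from the list and saves one node.
      remainder : ∀ α → Representable (λ x → ⟦ Trace x ⟧ xor h x) n α
      remainder α with follow α
      ... | β , α≤β , α₀≤β , (c , short , rep) , t , t∈c , s , s⊑t , ρs≡β , s₀⊑s , hs
        with ∈⇒↭ t∈c
      ... | c′ , c↭ = representable-≤ α≤β
        ( c′
        , ℕ.s≤s⁻¹ (subst (ℕ._≤ suc n) (↭-length c↭) short)
        , record
          { high   = λ u∈c′ → high rep (∈-resp-↭ (↭-sym c↭) (there u∈c′))
          ; agrees = c′-agrees
          })
        where
        Trace≡below : ∀ {x} → ρ x ≤ β → ⟦ Trace x ⟧ ≡ ⟦ x ⊑ t ⟧
        Trace≡below {x} ρx≤β = ⟦⟧-cong forward backward
          where
          ρx≤ρs : ρ x ≤ ρ s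
          ρx≤ρs = subst (ρ x ≤_) (sym ρs≡β) ρx≤β

          forward : Trace x → x ⊑ t
          forward (u , x⊑u , s₀⊑u , hu) with directed s₀⊑u hu s₀⊑s hs
          ... | w , u⊑w , s⊑w = ⊑-trans (⊑-bounded (⊑-trans x⊑u u⊑w) s⊑w ρx≤ρs) s⊑t

          backward : x ⊑ t → Trace x
          backward x⊑t = s , ⊑-bounded x⊑t s⊑t ρx≤ρs , s₀⊑s , hs

        c′-agrees : ∀ {x} → ρ x ≤ β → ⟦ Trace x ⟧ xor h x ≡ value c′ x
        c′-agrees {x} ρx≤β = begin
          ⟦ Trace x ⟧ xor h x                          ≡⟨ cong₂ _xor_ (Trace≡below ρx≤β) (agrees rep ρx≤β) ⟩
          ⟦ x ⊑ t ⟧ xor value c x                  ≡⟨ cong (⟦ x ⊑ t ⟧ xor_) (value-↭ x c↭) ⟩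
          ⟦ x ⊑ t ⟧ xor (⟦ x ⊑ t ⟧ xor value c′ x) ≡⟨ xor-involutive ⟦ x ⊑ t ⟧ _ ⟩
          value c′ x                               ∎
          where open ≡-Reasoning

    Coherent : (Node → Bool) → Set
    Coherent h = ∀ α → ∃ (Represents h α)

    -- Coherent sequences as finite sums of uncountable branches.

    module Main (isOmega₁ : IsOmega₁ κ) (Λ : Cardinal)
                (branches : uncountableBranches T ≈ᶜ ∣ Λ ∣) where
      open Omega₁ isOmega₁

      private
        module branches = Bijection branches

      Label : Set
      Label = Cardinal.Carrier Λ

      branch : Label → UncountableBranch T
      branch l = proj₁ (branches.surjective l)

      label-branch : ∀ l → branches.to (branch l) ≡ l
      label-branch l = proj₂ (branches.surjective l) (id , id)

      nodesOf : Label → Pred Node 0ℓ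
      nodesOf l = proj₁ (branch l)

      nodesOf-injective : ∀ {l m} → nodesOf l ≐ nodesOf m → l ≡ m
      nodesOf-injective {l} {m} eq =
        trans (sym (label-branch l)) (trans (branches.cong {branch l} {branch m} eq) (label-branch m))

      nodesOf-surjective : ∀ {B} → IsBranch T B → Cofinal B → ∃ λ l → nodesOf l ≐ B
      nodesOf-surjective {B} isBranch cofinal =
        branches.to 𝔅 , branches.injective {branch (branches.to 𝔅)} {𝔅} (label-branch (branches.to 𝔅))
        where
        𝔅 : UncountableBranch T
        𝔅 = B , isBranch , cofinal⇒uncountable cofinal

      nodesOf-cofinal : ∀ l → Cofinal (nodesOf l)
      nodesOf-cofinal l = let _ , isBranch , unc = branch l in
        uncountable⇒cofinal (IsBranch.isChain isBranch) unc

      -- Lets a single node high on a branch stand for the whole branch on the lower levels.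
      below-branch : ∀ {l s t} → nodesOf l t → ρ s ≤ ρ t → ⟦ s ⊑ t ⟧ ≡ ⟦ nodesOf l s ⟧
      below-branch {l} t∈l ρs≤ρt = let _ , isBranch , _ = branch l in ⟦⟧-cong
        (λ s⊑t → branch-downClosed isBranch s⊑t t∈l)
        (λ s∈l → comparable⇒⊑ (IsBranch.isChain isBranch s∈l t∈l) ρs≤ρt)

      crossing : List Label → Node → Bool
      crossing ls s = parity (λ l → ⟦ nodesOf l s ⟧) ls

      -- Induction on the bound: if some level needs `suc n` nodes, the trace from `Peel` is one of
      -- the labelled branches and its subtraction lowers the bound; if no level does, `n` is
      -- already a bound.
      sum-of-branches : ∀ n (h : Node → Bool) → (∀ α → Representable h n α) →
                        ∃ λ ls → ∀ s → h s ≡ crossing ls s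
      sum-of-branches zero h small = [] , vanishes
        where
        vanishes : ∀ s → h s ≡ false
        vanishes s with small (ρ s)
        ... | [] , _ , rep = agrees rep ≤-refl
      sum-of-branches (suc n) h small with em {P = ∃ λ α → ¬ Representable h n α}
      ... | no all-small = sum-of-branches n h λ α → by-contradiction λ ¬r → all-small (α , ¬r)
      ... | yes (α₀ , needed)
        with nodesOf-surjective (cofinal⇒branch Trace-chain Trace-downClosed Trace-cofinal) Trace-cofinal
           | sum-of-branches n _ remainder
        where open Peel small needed
      ...   | l , l⊆Trace , Trace⊆l | ls , eq = l ∷ ls , λ s → begin
        h s                                 ≡⟨ xor-involutive ⟦ Trace s ⟧ (h s) ⟨
        ⟦ Trace s ⟧ xor (⟦ Trace s ⟧ xor h s)       ≡⟨ cong₂ _xor_ (⟦⟧-cong Trace⊆l l⊆Trace) (eq s) ⟩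
        ⟦ nodesOf l s ⟧ xor crossing ls s   ∎
        where
        open ≡-Reasoning
        open Peel small needed using (Trace)

      -- If for each `n` some level needed more than `n` nodes, these countably many levels would
      -- have a common bound `β`, and the finite list at `β` would serve at all of them.
      coherent⇒bounded : ∀ {h} → Coherent h → ∃ λ n → ∀ α → Representable h n α
      coherent⇒bounded {h} coherent = by-contradiction λ unbounded →
        let bad : ∀ n → ∃ λ α → ¬ Representable h n α
            bad n = ¬∀⇒∃¬ λ small → unbounded (n , small)
            β , β-bound = bounded-sequence (λ n → proj₁ (bad n))
            c , rep = coherent β
        in proj₂ (bad (length c)) (representable-≤ (β-bound (length c)) (c , ℕ.≤-refl , rep))

      coherent⇒sum : ∀ {h} → Coherent h → ∃ λ ls → ∀ s → h s ≡ crossing ls s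
      coherent⇒sum {h} coherent = let n , small = coherent⇒bounded coherent in
        sum-of-branches n h small

      -- The structure.

      record Point : Set where
        field
          level : Carrier
          nodes : List Node
          high  : ∀ {t} → t ∈ nodes → level ≤ ρ t

      open Point

      infix 4 _~_
      record _~_ (x y : Point) : Set where
        constructor _,_
        field
          level-≡ : level x ≡ level y
          value-≡ : ∀ {s} → ρ s ≤ level x → value (nodes x) s ≡ value (nodes y) s

      open _~_

      ~-refl : ∀ {x} → x ~ x
      ~-refl = refl , λ _ → refl

      ~-sym : ∀ {x y} → x ~ y → y ~ x
      ~-sym (refl , eq) = refl , λ ρs≤α → sym (eq ρs≤α)

      ~-trans : ∀ {x y z} → x ~ y → y ~ z → x ~ z
      ~-trans (refl , eq) (refl , eq′) = refl , λ ρs≤α → trans (eq ρs≤α) (eq′ ρs≤α)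

      points : Setoid 0ℓ 0ℓ
      points = record
        { Carrier       = Point
        ; _≈_           = _~_
        ; isEquivalence = record { refl = ~-refl ; sym = ~-sym ; trans = ~-trans }
        }

      -- y is the sum of d and the projection of x to the level of d.
      record Translate (d x y : Point) : Set where
        constructor translate
        field
          level-target : level y ≡ level d
          level-source : level d ≤ level x
          value-target : ∀ {s} → ρ s ≤ level d →
                         value (nodes y) s ≡ value (nodes x) s xor value (nodes d) s

      open Translate

      Translate-resp-~ : ∀ {d x x′ y y′} → x ~ x′ → y ~ y′ → Translate d x y → Translate d x′ y′
      Translate-resp-~ (refl , x≡x′) (refl , y≡y′) (translate refl d≤x eq) = translate refl d≤x λ ρs≤α →
        trans (sym (y≡y′ ρs≤α)) (trans (eq ρs≤α) (cong (_xor _) (x≡x′ (≤-trans ρs≤α d≤x))))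

      origin : Carrier → Point
      origin α = record { level = α ; nodes = [] ; high = λ () }

      -- One binary symbol per point `d` suffices for everything: for `d` a zero, `Translate d` is a
      -- projection and its loops name a level; on the level of `d` it is the translation by `d`.
      vocabulary : Vocabulary
      vocabulary = record
        { FunctionSymbol = ⊥
        ; RelationSymbol = Point
        ; functionArity  = λ ()
        ; relationArity  = λ _ → 2
        }

      module Model (points≈ω₁ : points ≈ᶜ ∣ κ ∣) where
        private
          module code = Bijection points≈ω₁

        encode : Point → Carrier
        encode = code.to

        decode : Carrier → Point
        decode α = proj₁ (code.surjective α)

        encode-decode : ∀ α → encode (decode α) ≡ α
        encode-decode α = proj₂ (code.surjective α) ~-refl

        decode-encode : ∀ x → decode (encode x) ~ x
        decode-encode x = code.injective (encode-decode (encode x))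

        -- Points are equal only up to `_~_`, so ordinals stand for their classes as elements of the
        -- universe.
        structure : Structure vocabulary
        structure = record
          { Universe = Carrier
          ; function = λ ()
          ; relation = λ { d (α ∷ β ∷ []) → Translate d (decode α) (decode β) }
          }

        open Automorphism

        -- Automorphisms are translations by coherent sequences.

        module Translation (f : Automorphism structure) where

          act : Point → Point
          act x = decode (to f (encode x))

          act-decode : ∀ α → encode (act (decode α)) ≡ to f α
          act-decode α = trans (encode-decode _) (cong (to f) (encode-decode α))

          act-translate : ∀ {d x y} → Translate d x y → Translate d (act x) (act y)
          act-translate {d} {x} {y} r =
            Equivalence.to (preserves-relation f d (encode x ∷ encode y ∷ []))
              (Translate-resp-~ (~-sym (decode-encode x)) (~-sym (decode-encode y)) r)

          -- The relation of the zero at the level of `x` holds between `x` and itself, and its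
          -- targets all lie on that level.
          act-level : ∀ x → level (act x) ≡ level x
          act-level x = level-target (act-translate {origin (level x)} {x} {x}
            (translate refl ≤-refl λ _ → sym (xor-identityʳ _)))

          -- The amount of the translation at `s`, read off from the image of the zero at the level
          -- of `s`.
          shift-by : Node → Bool
          shift-by s = value (nodes (act (origin (ρ s)))) s

          -- Zeros project to zeros and automorphisms preserve projections, so the images of the
          -- zeros cohere.
          act-origin : ∀ {α s} → ρ s ≤ α → value (nodes (act (origin α))) s ≡ shift-by s
          act-origin {α} {s} ρs≤α =
            let r = act-translate {origin (ρ s)} {origin α} {origin (ρ s)}
                      (translate refl ρs≤α λ _ → refl)
            in sym (trans (value-target r ≤-refl) (xor-identityʳ _))

          -- Every `x` is the translate by `x` of the zero at its level, and this relation is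
          -- preserved.
          act-value : ∀ x {s} → ρ s ≤ level x →
                      value (nodes (act x)) s ≡ shift-by s xor value (nodes x) s
          act-value x ρs≤α =
            let r = act-translate {x} {origin (level x)} {x} (translate refl ≤-refl λ _ → refl)
            in trans (value-target r ρs≤α) (cong (_xor _) (act-origin ρs≤α))

          shift-by-coherent : Coherent shift-by
          shift-by-coherent α = nodes (act (origin α)) , record
            { high   = λ {t} t∈ → subst (_≤ ρ t) (act-level (origin α)) (high (act (origin α)) t∈)
            ; agrees = λ ρs≤α → sym (act-origin ρs≤α)
            }

        open Translation

        shift-by-cong : ∀ {f g} → (∀ α → to f α ≡ to g α) → ∀ s → shift-by f s ≡ shift-by g s
        shift-by-cong f≗g s = cong (λ α → value (nodes (decode α)) s) (f≗g (encode (origin (ρ s))))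

        shift-by-injective : ∀ {f g} → (∀ s → shift-by f s ≡ shift-by g s) → ∀ α → to f α ≡ to g α
        shift-by-injective {f} {g} eq α =
          trans (sym (act-decode f α)) (trans (code.cong same) (act-decode g α))
          where
          x = decode α
          same : act f x ~ act g x
          same = trans (act-level f x) (sym (act-level g x)) , λ {s} ρs≤ →
            let ρs≤x = subst (ρ s ≤_) (act-level f x) ρs≤
            in trans (act-value f x ρs≤x)
                 (trans (cong (_xor _) (eq s)) (sym (act-value g x ρs≤x)))

        -- Translations by branches.

        module BranchTranslation (l : Label) where

          node : Carrier → Node
          node α = proj₁ (nodesOf-cofinal l α)

          node-high : ∀ α → α ≤ ρ (node α)
          node-high α = proj₂ (proj₂ (nodesOf-cofinal l α))

          add : Point → Point
          add x = record
            { level = level x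
            ; nodes = node (level x) ∷ nodes x
            ; high  = λ { (here refl) → node-high (level x) ; (there t∈) → high x t∈ }
            }

          add-value : ∀ x {s} → ρ s ≤ level x →
                      value (nodes (add x)) s ≡ ⟦ nodesOf l s ⟧ xor value (nodes x) s
          add-value x {s} ρs≤α = cong (_xor value (nodes x) s)
            (below-branch {l} (proj₁ (proj₂ (nodesOf-cofinal l (level x))))
              (≤-trans ρs≤α (node-high (level x))))

          add-cong : ∀ {x y} → x ~ y → add x ~ add y
          add-cong {x} {y} (refl , eq) = refl , λ {s} ρs≤α →
            trans (add-value x ρs≤α)
              (trans (cong (⟦ nodesOf l s ⟧ xor_) (eq ρs≤α)) (sym (add-value y ρs≤α)))

          add-involutive : ∀ x → add (add x) ~ x
          add-involutive x = refl , λ {s} ρs≤α →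
            trans (add-value (add x) ρs≤α)
              (trans (cong (⟦ nodesOf l s ⟧ xor_) (add-value x ρs≤α))
                (xor-involutive ⟦ nodesOf l s ⟧ _))

          add-translate : ∀ {d x y} → Translate d x y → Translate d (add x) (add y)
          add-translate {d} {x} {y} (translate refl d≤x eq) = translate refl d≤x λ {s} ρs≤α →
            trans (add-value y ρs≤α)
              (trans (cong (⟦ nodesOf l s ⟧ xor_) (eq ρs≤α))
                (trans (sym (xor-assoc ⟦ nodesOf l s ⟧ _ _))
                  (cong (_xor _) (sym (add-value x (≤-trans ρs≤α d≤x))))))

          fun : Carrier → Carrier
          fun α = encode (add (decode α))

          fun-involutive : ∀ α → fun (fun α) ≡ α
          fun-involutive α = trans
            (code.cong (~-trans (add-cong (decode-encode (add (decode α)))) (add-involutive (decode α))))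
            (encode-decode α)

          fun-translate : ∀ {d α β} → Translate d (decode α) (decode β) →
                          Translate d (decode (fun α)) (decode (fun β))
          fun-translate {d} {α} {β} r =
            Translate-resp-~ (~-sym (decode-encode (add (decode α))))
                             (~-sym (decode-encode (add (decode β))))
                             (add-translate {d} {decode α} {decode β} r)

          automorphism : Automorphism structure
          automorphism = record
            { to                 = fun
            ; bijective          =
                (λ {α} {β} eq → trans (sym (fun-involutive α)) (trans (cong fun eq) (fun-involutive β)))
              , λ β → fun β , λ { refl → fun-involutive β }
            ; preserves-function = λ ()
            -- The converse direction applies `fun` once more, since `fun` is its own inverse.
            ; preserves-relation = λ { d (α ∷ β ∷ []) → mk⇔ fun-translate λ r →
                subst₂ (λ α β → Translate d (decode α) (decode β))
                  (fun-involutive α) (fun-involutive β) (fun-translate r) }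
            }

        open BranchTranslation

        Λ≤automorphisms : ∣ Λ ∣ ≤ᶜ automorphisms structure
        Λ≤automorphisms = record
          { to        = automorphism
          ; cong      = λ { refl _ → refl }
          ; injective = λ {l} {m} eq → nodesOf-injective
              ( (λ {s} s∈l → ⟦⟧-witness (trans (sym (same eq s)) (⟦⟧-true s∈l)))
              , (λ {s} s∈m → ⟦⟧-witness (trans (same eq s) (⟦⟧-true s∈m))) )
          }
          where
          -- The coefficient at `s` of the translated zero of level `ρ s` tells whether `s` lies on
          -- the branch.
          same : ∀ {l m} → (∀ α → fun l α ≡ fun m α) → ∀ s → ⟦ nodesOf l s ⟧ ≡ ⟦ nodesOf m s ⟧
          same {l} {m} eq s = begin
            ⟦ nodesOf l s ⟧           ≡⟨ on-origin l ⟨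
            value (nodes (add l o)) s ≡⟨ value-≡ (code.injective (eq (encode (origin (ρ s))))) ρs≤o ⟩
            value (nodes (add m o)) s ≡⟨ on-origin m ⟩
            ⟦ nodesOf m s ⟧           ∎
            where
            open ≡-Reasoning
            o : Point
            o = decode (encode (origin (ρ s)))

            o~origin : o ~ origin (ρ s)
            o~origin = decode-encode (origin (ρ s))

            ρs≤o : ρ s ≤ level o
            ρs≤o = inj₂ (sym (level-≡ o~origin))

            on-origin : ∀ k → value (nodes (add k o)) s ≡ ⟦ nodesOf k s ⟧
            on-origin k = trans (add-value k o ρs≤o)
              (trans (cong (⟦ nodesOf k s ⟧ xor_) (value-≡ o~origin ρs≤o)) (xor-identityʳ _))

        -- Counting the automorphisms and the points.

        module _ (codeΛ : List Label → Label) (codeΛ-injective : Injective _≡_ _≡_ codeΛ) where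

          -- The shift determines the automorphism and is a finite sum of branches. Several lists
          -- may have the same sum, so `classify` takes the least code.
          automorphisms≤Λ : automorphisms structure ≤ᶜ ∣ Λ ∣
          automorphisms≤Λ = WellOrdered.classify Λ (automorphisms structure)
            (λ f l → ∃ λ ls → (∀ s → shift-by f s ≡ crossing ls s) × codeΛ ls ≡ l)
            (λ f → let ls , eq = coherent⇒sum (shift-by-coherent f) in codeΛ ls , ls , eq , refl)
            (λ {f} {g} f≗g (ls , eq , coded) →
               ls , (λ s → trans (sym (shift-by-cong {f} {g} f≗g s)) (eq s)) , coded)
            λ {f} {g} (ls , eq , coded) (ls′ , eq′ , coded′) →
              shift-by-injective {f} {g} λ s →
                trans (eq s) (trans (cong (λ ks → crossing ks s)
                  (codeΛ-injective (trans coded (sym coded′)))) (sym (eq′ s)))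

          automorphisms≈Λ : automorphisms structure ≈ᶜ ∣ Λ ∣
          automorphisms≈Λ = CantorBernstein.bijection automorphisms≤Λ Λ≤automorphisms

      -- Equivalent points can have different lists, so the least code over the class is taken;
      -- conversely the zeros are distinct on distinct levels.
      points≈ω₁ : (∀ α → subset (Level[_] T κ α) ≤ᶜ ∣ κ ∣) → points ≈ᶜ ∣ κ ∣
      points≈ω₁ levels = CantorBernstein.bijection
        (classify points (λ x α → ∃ λ y → y ~ x × encode y ≡ α)
          (λ x → encode x , x , ~-refl , refl)
          (λ x~x′ (y , y~x , coded) → y , ~-trans y~x x~x′ , coded)
          λ { (y , y~x , refl) (z , z~x′ , eq) →
              ~-trans (~-sym y~x) (~-trans (encode-injective (sym eq)) z~x′) })
        (record { to = origin ; cong = λ { refl → ~-refl } ; injective = level-≡ })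
        where
        open ListCode (square (IsOmega₁.uncountable isOmega₁))
                      (proj₂ (proj₂ (distinct-elements (IsOmega₁.uncountable isOmega₁))))

        -- A node is determined by its height and its index in that level, which has at most ω₁
        -- nodes.
        nodePair : Node → Carrier × Carrier
        nodePair t = ρ t , Injection.to (levels (ρ t)) (t , proj₂ (HasHeight.bounded height t))

        nodeCode : Node → Carrier
        nodeCode t = pair (nodePair t)

        nodeCode-injective : Injective _≡_ _≡_ nodeCode
        nodeCode-injective {s} {t} eq = same-level (proj₂ (HasHeight.bounded height s))
          (proj₂ (HasHeight.bounded height t)) (,-injectiveˡ eq′) (,-injectiveʳ eq′)
          where
          eq′ = pair-injective {nodePair s} {nodePair t} eq

          -- Stated for arbitrary `α` and `β`, so that the equality of the two heights can be
          -- eliminated before comparing indices.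
          same-level : ∀ {α β} (p : Level[_] T κ α s) (q : Level[_] T κ β t) → α ≡ β →
            Injection.to (levels α) (s , p) ≡ Injection.to (levels β) (t , q) → s ≡ t
          same-level p q refl = Injection.injective (levels _)

        nodesCode : Point → Carrier
        nodesCode x = code (map nodeCode (nodes x))

        encode : Point → Carrier
        encode x = pair (level x , nodesCode x)

        encode-injective : ∀ {x y} → encode x ≡ encode y → x ~ y
        encode-injective {x} {y} eq =
          ,-injectiveˡ eq′ , λ {s} _ → cong (λ c → value c s)
            (map-injective nodeCode-injective
              (code-injective {map nodeCode (nodes x)} {map nodeCode (nodes y)} (,-injectiveʳ eq′)))
          where
          eq′ = pair-injective {level x , nodesCode x} {level y , nodesCode y} eq

theorem14 :
    (∀ {ℓ} → ExcludedMiddle ℓ) →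
    (ω₁ Λ : Cardinal) →
    IsOmega₁ ω₁ →
    ∣ ω₁ ∣ <ᶜ ∣ Λ ∣ →
    ∣ Λ ∣ <ᶜ 2^ ω₁ →
    Σ[ T ∈ Tree ] (HasHeight T ω₁ × uncountableBranches T ≈ᶜ ∣ Λ ∣ × (∀ α → subset (Level[_] T ω₁ α) ≤ᶜ ∣ ω₁ ∣)) →
    Σ[ L ∈ Vocabulary ] Σ[ M ∈ Structure L ] (setoid (Structure.Universe M) ≈ᶜ ∣ ω₁ ∣ × automorphisms M ≈ᶜ ∣ Λ ∣)
theorem14 em ω₁ Λ isOmega₁ (ω₁≤Λ , _) _ (T , height , branches , levels) =
  vocabulary , structure , Identity.bijection _ , automorphisms≈Λ code code-injective
  where
  open Classical em
  open BranchSums em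
  open Rank T ω₁ height
  open Main isOmega₁ Λ branches
  open Model (points≈ω₁ levels)

  Λ-uncountable : Uncountable ∣ Λ ∣
  Λ-uncountable Λ≤ℕ = IsOmega₁.uncountable isOmega₁ (Composition.injection ω₁≤Λ Λ≤ℕ)

  -- By Hessenberg's theorem for `Λ`, finite lists of branches inject into `Λ`.
  open ListCode (WellOrdered.square Λ Λ-uncountable)
                (proj₂ (proj₂ (WellOrdered.distinct-elements Λ Λ-uncountable)))
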